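{- Let $n \geq 3$ and let $F$ be a strongly independent set of vertices in the hypercube $Q_n$. Then $Q_n - F$ is $(n-1)$-connected.
   Context: The hypercube $Q_n$ has vertex set $\{0,1\}^n$, two vertices being adjacent iff they differ in exactly one coordinate. For $F \subseteq V(Q_n)$, $Q_n - F$ is the subgraph induced on $V(Q_n)\setminus F$. A set $F \subseteq V(Q_n)$ is strongly independent (or distant) if $N[u] \cap N[v] = \emptyset$ for every two distinct $u, v \in F$, where $N[u]$ is the closed neighbourhood of $u$; equivalently, any two distinct vertices of $F$ are at distance at least $3$. A graph is $r$-connected if it has more than $r$ vertices and remains connected after deleting any set of fewer than $r$ vertices. -}

module Defs where

open import Data.Bool using (Bool; T; not)
open import Data.Fin using (Fin)
open import Data.Nat using (ℕ; suc; _<_)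
open import Data.Product using (Σ-syntax; ∃; ∃!; _×_; _,_; proj₁)
open import Data.Sum using (_⊎_)
open import Data.Vec using (Vec; lookup)
open import Function using (_∘_; _on_; _↔_; _↣_)
open import Relation.Binary.Construct.Closure.ReflexiveTransitive using (Star)
open import Relation.Binary.Core using (Rel)
open import Relation.Binary.Definitions using (Irreflexive; Symmetric)
open import Relation.Binary.PropositionalEquality using (_≡_; _≢_; refl; ≢-sym)
open import Relation.Unary using (Pred; Empty; _∩_)

record Graph : Set₁ where
  field
    Vertex : Set
    Adj    : Rel Vertex _
    irrefl : Irreflexive _≡_ Adj
    symm   : Symmetric Adj

open Graph public

-- Sets of vertices are given by their Boolean characteristic functions, as in
-- Data.Fin.Subset.  Membership is then decidable with unique proofs, so the
-- subtypes below have exactly one element for each member of the set.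

VertexSet : Graph → Set
VertexSet G = Vertex G → Bool

⟦_⟧ : {A : Set} → (A → Bool) → Pred A _
⟦ X ⟧ = T ∘ X

infixl 6 _-_

_-_ : (G : Graph) → VertexSet G → Graph
G - X = record
  { Vertex = Σ[ v ∈ Vertex G ] T (not (X v))
  ; Adj    = Adj G on proj₁
  ; irrefl = λ { refl → irrefl G refl }
  ; symm   = symm G
  }

N[_] : (G : Graph) → Vertex G → Pred (Vertex G) _
N[ G ] u w = w ≡ u ⊎ Adj G u w

StronglyIndependent : (G : Graph) → VertexSet G → Set
StronglyIndependent G F =
  ∀ {u v} → ⟦ F ⟧ u → ⟦ F ⟧ v → u ≢ v → Empty (N[ G ] u ∩ N[ G ] v)

-- The first component says that the graph is nonempty.

Connected : Graph → Set
Connected G = Vertex G × (∀ u v → Star (Adj G) u v)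

MoreThan : ℕ → Set → Set
MoreThan r A = Fin (suc r) ↣ A

FewerThan : ℕ → Set → Set
FewerThan r A = ∃ λ k → k < r × (Fin k ↔ A)

_-Connected_ : ℕ → Graph → Set
r -Connected G =
  MoreThan r (Vertex G) ×
  (∀ (X : VertexSet G) → FewerThan r (∃ ⟦ X ⟧) → Connected (G - X))

Q : ℕ → Graph
Q n = record
  { Vertex = Vec Bool n
  ; Adj    = λ u v → ∃! _≡_ λ i → lookup u i ≢ lookup v i
  ; irrefl = λ { refl (_ , uᵢ≢uᵢ , _) → uᵢ≢uᵢ refl }
  ; symm   = λ (i , uᵢ≢vᵢ , unique) → i , ≢-sym uᵢ≢vᵢ , λ ne → unique (≢-sym ne)
  }

{-# OPTIONS --safe #-}

-- Induction on the dimension, splitting Q (n + 1) into the two halves given by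
-- the first coordinate; X denotes the set of deleted vertices outside F.  If a
-- half avoids X, it is connected by induction, and every vertex of the other
-- half reaches it: either across its own edge, or, when the opposite vertex is
-- in F, across the edge at one of the n neighbouring columns.  Otherwise X meets
-- both halves in few vertices, both are connected by induction, and a column
-- avoiding F ∪ X joins them.  Such a column exists because the n columns
-- adjacent to a vertex of F contain no other vertex of F, and X has fewer than
-- n vertices.

module Submission where

open import Defs
open import Algebra.Properties.CommutativeSemigroup using (interchange)
open import Data.Bool using (Bool; true; false; T; not; _∨_; if_then_else_)
open import Data.Bool.Properties using (_≟_; T-irrelevant; not-¬)
open import Data.Fin using (Fin; zero; suc)
import Data.Fin.Properties as Fin
open import Data.Nat using (ℕ; zero; suc; pred; _+_; _≤_; _<_; _∸_; z≤n; s≤s; s≤s⁻¹)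
open import Data.Nat.Properties hiding (_≟_)
open import Data.Product using (∃; _×_; _,_; proj₁; proj₂)
open import Data.Sum using (_⊎_; inj₁; inj₂; [_,_])
open import Data.Sum.Function.Propositional using (_⊎-↣_)
open import Data.Vec using (Vec; []; _∷_; lookup; replicate; updateAt)
open import Data.Vec.Properties using (∷-injectiveʳ; lookup∘updateAt; lookup∘updateAt′)
open import Function using (_∘_; _↣_; _↔_; mk↣; Injection)
open import Function.Construct.Composition using (_↣-∘_)
open import Function.Properties.Inverse using (↔⇒↣; ↔-sym)
open import Relation.Binary.Construct.Closure.ReflexiveTransitive
  using (Star; ε; _◅_; _◅◅_; gmap; reverse)
open import Relation.Binary.PropositionalEquality
  using (_≡_; _≢_; refl; sym; trans; cong; subst; subst₂)
open import Relation.Nullary using (¬_; yes; no; contradiction)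

private
  variable
    n : ℕ

-- Boolean membership.

T-excluded-middle : ∀ b → T b ⊎ T (not b)
T-excluded-middle true  = inj₁ _
T-excluded-middle false = inj₂ _

¬T⇒T-not : ∀ b → ¬ T b → T (not b)
¬T⇒T-not true  ¬t = ¬t _
¬T⇒T-not false _  = _

T-not-∨ : ∀ a b → T (not (a ∨ b)) → T (not a) × T (not b)
T-not-∨ false false _ = _

member-≡ : {A : Set} {f : A → Bool} {p q : ∃ ⟦ f ⟧} → proj₁ p ≡ proj₁ q → p ≡ q
member-≡ refl = cong (_ ,_) (T-irrelevant _ _)

-- Adjacency in the hypercube.

flip : Vec Bool n → Fin n → Vec Bool n
flip v i = updateAt v i not

flip-changes : (v : Vec Bool n) (i : Fin n) → lookup v i ≢ lookup (flip v i) i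
flip-changes v i eq = not-¬ refl (trans eq (lookup∘updateAt i v))

flip-adj : (v : Vec Bool n) (i : Fin n) → Adj (Q n) v (flip v i)
flip-adj v i = i , flip-changes v i , unique
  where
  unique : ∀ {j} → lookup v j ≢ lookup (flip v i) j → i ≡ j
  unique {j} ne with i Fin.≟ j
  ... | yes i≡j = i≡j
  ... | no  i≢j = contradiction (sym (lookup∘updateAt′ j i (i≢j ∘ sym) v)) ne

flip-≢ : (v : Vec Bool n) (i : Fin n) → flip v i ≢ v
flip-≢ v i eq = flip-changes v i (cong (λ w → lookup w i) (sym eq))

flip-injective : (v : Vec Bool n) {i j : Fin n} → flip v i ≡ flip v j → i ≡ j
flip-injective v {i} {j} eq with i Fin.≟ j
... | yes i≡j = i≡j
... | no  i≢j = contradiction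
  (trans (sym (lookup∘updateAt′ i j i≢j v)) (cong (λ w → lookup w i) (sym eq)))
  (flip-changes v i)

∷-adj : ∀ b {u v : Vec Bool n} → Adj (Q n) u v → Adj (Q (suc n)) (b ∷ u) (b ∷ v)
∷-adj b (i , ne , unique) = suc i , ne , λ
  { {zero}  b≢b → contradiction refl b≢b
  ; {suc j} ne′ → cong suc (unique ne′)
  }

across-adj : ∀ {a b} → a ≢ b → (v : Vec Bool n) → Adj (Q (suc n)) (a ∷ v) (b ∷ v)
across-adj a≢b v = zero , a≢b , λ
  { {zero}  _  → refl
  ; {suc j} ne → contradiction refl ne
  }

-- Halves of the cube and cardinalities.

half : Bool → VertexSet (Q (suc n)) → VertexSet (Q n)
half b X v = X (b ∷ v)

count : VertexSet (Q n) → ℕ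
count {zero}  X = if X [] then 1 else 0
count {suc n} X = count (half false X) + count (half true X)

count-half : ∀ a b → a ≢ b → (X : VertexSet (Q (suc n))) →
  count (half a X) + count (half b X) ≡ count X
count-half false false a≢b X = contradiction refl a≢b
count-half false true  _   X = refl
count-half true  false _   X = +-comm (count (half true X)) _
count-half true  true  a≢b X = contradiction refl a≢b

count-half-≤ : ∀ b (X : VertexSet (Q (suc n))) → count (half b X) ≤ count X
count-half-≤ false X = m≤m+n _ _
count-half-≤ true  X = m≤n+m _ _

member⇒count>0 : (X : VertexSet (Q n)) (v : Vec Bool n) → T (X v) → 0 < count X
member⇒count>0 X []      t with X []
... | true = s≤s z≤n
member⇒count>0 X (b ∷ v) t = ≤-trans (member⇒count>0 (half b X) v t) (count-half-≤ b X)

count≡0⇒∉ : (X : VertexSet (Q n)) → count X ≡ 0 → ∀ v → T (not (X v))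
count≡0⇒∉ X count≡0 v = ¬T⇒T-not (X v) λ t → <⇒≢ (member⇒count>0 X v t) (sym count≡0)

count-∨ : (X Y : VertexSet (Q n)) → count (λ v → X v ∨ Y v) ≤ count X + count Y
count-∨ {zero} X Y with X [] | Y []
... | true  | _     = s≤s z≤n
... | false | true  = ≤-refl
... | false | false = ≤-refl
count-∨ {suc n} X Y = ≤-trans
  (+-mono-≤ (count-∨ (half false X) (half false Y)) (count-∨ (half true X) (half true Y)))
  (≤-reflexive (interchange +-commutativeSemigroup (count (half false X)) _ _ _))

-- Ties `count` to the cardinalities expressed through `Fin` in `FewerThan`, and supplies a member
-- of any set of nonzero count.
enumerate : (X : VertexSet (Q n)) → Fin (count X) ↣ ∃ ⟦ X ⟧
enumerate {zero} X with X [] in eq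
... | true  = mk↣ {to = λ _ → [] , subst T (sym eq) _} λ { {zero} {zero} _ → refl }
... | false = mk↣ {to = λ ()} λ { {()} }
enumerate {suc n} X =
  mk↣ {to = glue} glue-injective
    ↣-∘ ((enumerate (half false X) ⊎-↣ enumerate (half true X)) ↣-∘ ↔⇒↣ Fin.+↔⊎)
  where
  glue : ∃ ⟦ half false X ⟧ ⊎ ∃ ⟦ half true X ⟧ → ∃ ⟦ X ⟧
  glue = [ (λ (v , t) → false ∷ v , t) , (λ (v , t) → true ∷ v , t) ]
  glue-injective : ∀ {p q} → glue p ≡ glue q → p ≡ q
  glue-injective {inj₁ _} {inj₁ _} eq = cong inj₁ (member-≡ (∷-injectiveʳ (cong proj₁ eq)))
  glue-injective {inj₂ _} {inj₂ _} eq = cong inj₂ (member-≡ (∷-injectiveʳ (cong proj₁ eq)))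

-- Neighbours and columns avoiding a small set.

-- Induction on the dimension: if the neighbour across the first coordinate lies in `X`, it uses up
-- one element of `X`, so the half containing the given vertex has fewer than `n` of them.
∃-neighbour-∉ : (X : VertexSet (Q n)) → count X < n → ∀ v → ∃ λ i → T (not (X (flip v i)))
∃-neighbour-∉ {suc n} X count<n (b ∷ v) with T-excluded-middle (X (not b ∷ v))
... | inj₂ t = zero , t
... | inj₁ t with ∃-neighbour-∉ (half b X) smaller v
  where
  open ≤-Reasoning
  smaller : count (half b X) < n
  smaller = s≤s⁻¹ (begin
    suc (suc (count (half b X)))                    ≤⟨ s≤s (+-monoˡ-≤ _ (member⇒count>0 (half (not b) X) v t)) ⟩
    suc (count (half (not b) X) + count (half b X)) ≡⟨ cong suc (count-half (not b) b (not-¬ refl ∘ sym) X) ⟩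
    suc (count X)                                   ≤⟨ count<n ⟩
    suc n                                           ∎)
... | i , t′ = suc i , t′

-- Projecting `X` along the first coordinate does not increase its size, so the neighbour lemma
-- applies to the union of the two halves.
∃-column-∉ : (X : VertexSet (Q (suc n))) → count X < n → ∀ v →
  ∃ λ i → ∀ c → T (not (X (c ∷ flip v i)))
∃-column-∉ X count<n v
  with i , t ← ∃-neighbour-∉ (λ w → half false X w ∨ half true X w)
                 (≤-<-trans (count-∨ (half false X) (half true X)) count<n) v
  = i , λ { false → proj₁ (split i t) ; true → proj₂ (split i t) }
  where
  split : ∀ i → _ → _
  split i = T-not-∨ (X (false ∷ flip v i)) (X (true ∷ flip v i))

empty? : (X : VertexSet (Q n)) → ∃ ⟦ X ⟧ ⊎ (∀ v → T (not (X v)))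
empty? X with count X in eq | Injection.to (enumerate X)
... | zero  | _ = inj₂ (count≡0⇒∉ X eq)
... | suc _ | f = inj₁ (f zero)

-- Vertices whose surroundings avoid `F`.

-- Leaves open whether `v` itself is in `F`, so that members of `F` and, for empty `F`, arbitrary
-- vertices are treated alike.
ClearAround : (G : Graph) → VertexSet G → Vertex G → Set
ClearAround G F v = ∀ {w z} → w ≢ v → N[ G ] v z → N[ G ] w z → T (not (F w))

member⇒clear : (G : Graph) (F : VertexSet G) → StronglyIndependent G F →
  ∀ {v} → T (F v) → ClearAround G F v
member⇒clear G F ind Fv {w} {z} w≢v vz wz =
  ¬T⇒T-not (F w) λ Fw → ind Fv Fw (w≢v ∘ sym) z (vz , wz)

∃-clear : (F : VertexSet (Q n)) → StronglyIndependent (Q n) F → ∃ (ClearAround (Q n) F)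
∃-clear {n} F ind with empty? F
... | inj₁ (v , Fv) = v , member⇒clear (Q n) F ind Fv
... | inj₂ F-empty  = replicate n false , λ {w} _ _ _ → F-empty w

clear⇒neighbour-∉ : (F : VertexSet (Q n)) → ∀ {v} → ClearAround (Q n) F v →
  ∀ i → T (not (F (flip v i)))
clear⇒neighbour-∉ F {v} clear i = clear (flip-≢ v i) (inj₂ (flip-adj v i)) (inj₁ refl)

-- Both vertices of the column of `flip v i` have `b ∷ flip v i` in their closed neighbourhoods, and
-- this is a neighbour of `b ∷ v`.
clear⇒column-∉ : (F : VertexSet (Q (suc n))) → ∀ {b v} → ClearAround (Q (suc n)) F (b ∷ v) →
  ∀ i c → T (not (F (c ∷ flip v i)))
clear⇒column-∉ F {b} {v} clear i c =
  clear (flip-≢ v i ∘ ∷-injectiveʳ) (inj₂ (∷-adj b (flip-adj v i))) meets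
  where
  meets : N[ Q _ ] (c ∷ flip v i) (b ∷ flip v i)
  meets with c ≟ b
  ... | yes refl = inj₁ refl
  ... | no  c≢b  = inj₂ (across-adj c≢b (flip v i))

half-independent : ∀ b (F : VertexSet (Q (suc n))) →
  StronglyIndependent (Q (suc n)) F → StronglyIndependent (Q n) (half b F)
half-independent {n} b F ind Fu Fv u≢v z (uz , vz) =
  ind Fu Fv (u≢v ∘ ∷-injectiveʳ) (b ∷ z) (∷-N uz , ∷-N vz)
  where
  ∷-N : ∀ {u} → N[ Q n ] u z → N[ Q (suc n) ] (b ∷ u) (b ∷ z)
  ∷-N (inj₁ z≡u) = inj₁ (cong (b ∷_) z≡u)
  ∷-N (inj₂ adj) = inj₂ (∷-adj b adj)

-- Deleted sets viewed in the whole cube.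

extendFalse : ∀ b → (T (not b) → Bool) → Bool
extendFalse true  f = false
extendFalse false f = f _

extendFalse-≡ : ∀ b f t → extendFalse b f ≡ f t
extendFalse-≡ false f t = refl

extendFalse-member : ∀ b f → T (extendFalse b f) → ∃ λ t → T (f t)
extendFalse-member false f t = _ , t

module _ {F : VertexSet (Q n)} where

  -- Regards `X` as a subset of the whole cube, disjoint from `F`, so that `count` and `half` apply
  -- to it.
  extend : VertexSet (Q n - F) → VertexSet (Q n)
  extend X v = extendFalse (F v) λ v∉F → X (v , v∉F)

  extend-injection : (X : VertexSet (Q n - F)) → ∃ ⟦ extend X ⟧ ↣ ∃ ⟦ X ⟧
  extend-injection X = mk↣ {to = restrict} λ eq → member-≡ (cong (proj₁ ∘ proj₁) eq)
    where
    restrict : ∃ ⟦ extend X ⟧ → ∃ ⟦ X ⟧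
    restrict (v , t) with v∉F , t′ ← extendFalse-member (F v) _ t = (v , v∉F) , t′

  -- Pigeonhole principle, for the injections from `Fin (count (extend X))` through the members of
  -- `extend X` and of `X` into `Fin k`.
  count-extend-≤ : ∀ {k} (X : VertexSet (Q n - F)) → Fin k ↔ ∃ ⟦ X ⟧ → count (extend X) ≤ k
  count-extend-≤ X Fin↔X = Fin.injective⇒≤ (Injection.injective
    (↔⇒↣ (↔-sym Fin↔X) ↣-∘ (extend-injection X ↣-∘ enumerate (extend X))))

  survivor : (X : VertexSet (Q n - F)) → ∀ v → T (not (F v)) → T (not (extend X v)) →
    Vertex ((Q n - F) - X)
  survivor X v v∉F v∉X =
    (v , v∉F) , subst (T ∘ not) (extendFalse-≡ (F v) (λ v∉F → X (v , v∉F)) v∉F) v∉X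

-- Joining the two halves.

-- With this form `extend (half⁻ b X)` and `half b (extend X)` agree by definition, so bounds pass
-- between cube and half unchanged.
half⁻ : ∀ b {F : VertexSet (Q (suc n))} → VertexSet (Q (suc n) - F) → VertexSet (Q n - half b F)
half⁻ b X (v , v∉F) = X (b ∷ v , v∉F)

module _ {F : VertexSet (Q (suc n))} (X : VertexSet (Q (suc n) - F)) where

  private
    G : Graph
    G = (Q (suc n) - F) - X

    Half : Bool → Graph
    Half b = (Q n - half b F) - half⁻ b X

  embed : ∀ b → Vertex (Half b) → Vertex G
  embed b ((v , v∉F) , v∉X) = (b ∷ v , v∉F) , v∉X

  HalfConnected : Bool → Set
  HalfConnected b = ∀ u v → Star (Adj G) (embed b u) (embed b v)

  ReachesHalf : Bool → Vertex G → Set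
  ReachesHalf b u = ∃ λ w → Star (Adj G) u (embed b w)

  embed-connected : ∀ b → (∀ u v → Star (Adj (Half b)) u v) → HalfConnected b
  embed-connected b conn u v = gmap (embed b) (∷-adj b) (conn u v)

  connected-via-half : ∀ b → HalfConnected b → (∀ u → ReachesHalf b u) →
    ∀ u v → Star (Adj G) u v
  connected-via-half b conn reaches u v
    with u′ , u↝u′ ← reaches u | v′ , v↝v′ ← reaches v =
    u↝u′ ◅◅ conn u′ v′ ◅◅ reverse (λ {x} {y} → symm G {x} {y}) v↝v′

  cross : ∀ {a b} → a ≢ b → ∀ {u} (w : Vertex (Half a)) → Star (Adj G) u (embed a w) →
    let v = proj₁ (proj₁ w) in
    T (not (F (b ∷ v))) → T (not (extend X (b ∷ v))) → ReachesHalf b u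
  cross {b = b} a≢b ((v , _) , _) u↝w bv∉F bv∉X =
    survivor (half⁻ b X) v bv∉F bv∉X , u↝w ◅◅ across-adj a≢b v ◅ ε

  reaches-untouched-half : StronglyIndependent (Q (suc n)) F → count (extend X) < n →
    ∀ b → count (half b (extend X)) ≡ 0 → ∀ u → ReachesHalf b u
  reaches-untouched-half ind count<n b untouched ((a ∷ v , v∉F) , v∉X) with a ≟ b
  ... | yes refl = ((v , v∉F) , v∉X) , ε
  ... | no  a≢b  with T-excluded-middle (F (b ∷ v))
  ... | inj₂ bv∉F = cross a≢b _ ε bv∉F (count≡0⇒∉ (half b (extend X)) untouched v)
  ... | inj₁ bv∈F
    -- The edge to the opposite vertex is blocked by `F`, so the path first moves within its own
    -- half to a neighbouring column free of `F` and `X`.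
    with i , column∉X ← ∃-column-∉ (extend X) count<n v =
    cross a≢b (survivor (half⁻ a X) (flip v i) (column∉F i a) (column∉X a))
      (∷-adj a (flip-adj v i) ◅ ε) (column∉F i b) (column∉X b)
    where
    column∉F : ∀ i c → T (not (F (c ∷ flip v i)))
    column∉F = clear⇒column-∉ F (member⇒clear (Q (suc n)) F ind bv∈F)

  reaches-half-through-column : StronglyIndependent (Q (suc n)) F → count (extend X) < n →
    (∀ b → HalfConnected b) → ∀ b u → ReachesHalf b u
  reaches-half-through-column ind count<n conn b ((a ∷ v , v∉F) , v∉X) with a ≟ b
  ... | yes refl = ((v , v∉F) , v∉X) , ε
  ... | no  a≢b
    with c ∷ w , clear ← ∃-clear F ind
    with i , column∉X ← ∃-column-∉ (extend X) count<n w =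
    cross a≢b bridge (conn a ((v , v∉F) , v∉X) bridge) (column∉F i b) (column∉X b)
    where
    column∉F : ∀ i c′ → T (not (F (c′ ∷ flip w i)))
    column∉F = clear⇒column-∉ F clear
    bridge : Vertex (Half a)
    bridge = survivor (half⁻ a X) (flip w i) (column∉F i a) (column∉X a)

-- Truncation at m = 0 is intended: allowing X = ∅ there lets the induction start
-- at Q 1.
connected : ∀ m (F : VertexSet (Q (suc m))) → StronglyIndependent (Q (suc m)) F →
  (X : VertexSet (Q (suc m) - F)) → count (extend X) ≤ pred m →
  ∀ u v → Star (Adj ((Q (suc m) - F) - X)) u v
connected zero F ind X _ ((a ∷ [] , _) , _) ((b ∷ [] , _) , _) with a ≟ b
... | no  a≢b  = across-adj a≢b [] ◅ ε
-- The two vertices differ at most in their membership proofs, which are unique.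
... | yes refl = subst (Star _ _) (member-≡ (member-≡ refl)) ε
connected (suc m) F ind X few = split refl refl
  where
  Y = extend X
  half-connected : ∀ b → count (half b Y) ≤ pred m → HalfConnected X b
  half-connected b few-b = embed-connected X b
    (connected m (half b F) (half-independent b F ind) (half⁻ b X) few-b)
  via-untouched : ∀ b → count (half b Y) ≡ 0 → ∀ u v → Star (Adj ((Q (suc (suc m)) - F) - X)) u v
  via-untouched b untouched = connected-via-half X b
    (half-connected b (subst (_≤ pred m) (sym untouched) z≤n))
    (reaches-untouched-half X ind (s≤s few) b untouched)
  split : ∀ {k l} → count (half false Y) ≡ k → count (half true Y) ≡ l →
    ∀ u v → Star (Adj ((Q (suc (suc m)) - F) - X)) u v
  split {zero}  {_}     k≡ l≡ = via-untouched false k≡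
  split {suc _} {zero}  k≡ l≡ = via-untouched true l≡
  split {suc k} {suc l} k≡ l≡ = connected-via-half X false (halves false)
    (reaches-half-through-column X ind (s≤s few) halves false)
    where
    -- Since each half contains at least one deleted vertex, the other has at most `pred m`, as the
    -- induction hypothesis requires.
    few′ : suc k + suc l ≤ m
    few′ = subst₂ (λ k l → k + l ≤ m) k≡ l≡ few
    halves : ∀ b → HalfConnected X b
    halves false = half-connected false (subst (_≤ pred m) (sym k≡)
      (≤-trans (m<m+n k (s≤s z≤n)) (<⇒≤pred few′)))
    halves true  = half-connected true (subst (_≤ pred m) (sym l≡)
      (≤-trans (m≤n+m (suc l) k) (<⇒≤pred few′)))

theorem5p1 : (n : ℕ) → 3 ≤ n → (F : VertexSet (Q n)) →
    StronglyIndependent (Q n) F → (n ∸ 1) -Connected (Q n - F)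
theorem5p1 (suc m) _ F ind with v , clear ← ∃-clear F ind = many , survives
  where
  -- The `suc m` neighbours of the clear vertex serve twice: they are the more than `m` vertices
  -- required, and fewer than `m` deletions leave one of them, which gives nonemptiness.
  neighbour∉F : ∀ i → T (not (F (flip v i)))
  neighbour∉F = clear⇒neighbour-∉ F clear
  many : MoreThan m (Vertex (Q (suc m) - F))
  many = mk↣ {to = λ i → flip v i , neighbour∉F i} (flip-injective v ∘ cong proj₁)
  survives : ∀ X → FewerThan m (∃ ⟦ X ⟧) → Connected ((Q (suc m) - F) - X)
  survives X (k , k<m , Fin↔X)
    with i , v∉X ← ∃-neighbour-∉ (extend X) (≤-<-trans (count-extend-≤ X Fin↔X) (m<n⇒m<1+n k<m)) v =
    survivor X (flip v i) (neighbour∉F i) v∉X ,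
    connected m F ind X (≤-trans (count-extend-≤ X Fin↔X) (<⇒≤pred k<m))
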